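{- For every $p\geq 2$, there exists, up to isomorphism, exactly one $2p$-regular $(p+2)$-star colourable graph $G_{2p}$ on $(p+1)(p+2)$ vertices. Moreover, $G_{2p}$ is vertex-transitive, edge-transitive and Hamiltonian for every $p\geq 2$.
   Context: A $k$-star colouring of a graph is a proper vertex colouring with $k$ colours in which no path on 4 vertices receives only two colours. (Explicitly, $G_{2p}$ has vertex set $\{(i,j): i,j\in\{0,\dots,p+1\}, i\neq j\}$, with $(i,j)$ adjacent to $(k,\ell)$ iff either $k=j$ and $\ell\notin\{i,j\}$, or $k\notin\{i,j\}$ and $\ell=i$.) -}

module Defs where

open import Data.Nat using (ℕ; zero; suc; _+_; _*_; _∸_)
open import Data.Bool using (Bool; true; false; _∧_; _∨_; not)
open import Data.Fin using (Fin; toℕ; remQuot; punchIn; _≟_)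
open import Data.List using (length; filterᵇ; allFin)
open import Data.Product using (Σ; ∃; _×_; _,_; proj₁; proj₂)
open import Data.Sum using (_⊎_)
open import Function.Bundles using (_↔_; Inverse)
open import Relation.Nullary using (¬_)
open import Relation.Nullary.Decidable using (⌊_⌋)
open import Relation.Binary.PropositionalEquality using (_≡_; _≢_)

Graph : ℕ → Set
Graph n = Fin n → Fin n → Bool

Adj : ∀ {n} → Graph n → Fin n → Fin n → Set
Adj G u v = G u v ≡ true

IsSimpleGraph : ∀ {n} → Graph n → Set
IsSimpleGraph {n} G = (∀ u v → G u v ≡ G v u) × (∀ v → G v v ≡ false)

degree : ∀ {n} → Graph n → Fin n → ℕ
degree {n} G v = length (filterᵇ (G v) (allFin n))

IsRegular : ∀ {n} → ℕ → Graph n → Set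
IsRegular d G = ∀ v → degree G v ≡ d

IsProperColouring : ∀ {n k} → Graph n → (Fin n → Fin k) → Set
IsProperColouring G c = ∀ u v → Adj G u v → c u ≢ c v

-- star colouring: proper, and no path u-v-w-x on 4 distinct vertices
-- is 2-coloured (for a proper colouring this means c u = c w and c v = c x)
IsStarColouring : ∀ {n k} → Graph n → (Fin n → Fin k) → Set
IsStarColouring G c =
  IsProperColouring G c ×
  (∀ u v w x → u ≢ v → u ≢ w → u ≢ x → v ≢ w → v ≢ x → w ≢ x →
     Adj G u v → Adj G v w → Adj G w x →
     ¬ (c u ≡ c w × c v ≡ c x))

IsStarColourable : ∀ {n} → ℕ → Graph n → Set
IsStarColourable {n} k G = Σ (Fin n → Fin k) λ c → IsStarColouring G c

Isomorphic : ∀ {n m} → Graph n → Graph m → Set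
Isomorphic {n} {m} G H =
  Σ (Fin n ↔ Fin m) λ f → ∀ u v → H (Inverse.to f u) (Inverse.to f v) ≡ G u v

Automorphism : ∀ {n} → Graph n → Set
Automorphism {n} G =
  Σ (Fin n ↔ Fin n) λ f → ∀ u v → G (Inverse.to f u) (Inverse.to f v) ≡ G u v

IsVertexTransitive : ∀ {n} → Graph n → Set
IsVertexTransitive G =
  ∀ u v → Σ (Automorphism G) λ f → Inverse.to (proj₁ f) u ≡ v

IsEdgeTransitive : ∀ {n} → Graph n → Set
IsEdgeTransitive G =
  ∀ u v x y → Adj G u v → Adj G x y →
    Σ (Automorphism G) λ f →
      (Inverse.to (proj₁ f) u ≡ x × Inverse.to (proj₁ f) v ≡ y) ⊎
      (Inverse.to (proj₁ f) u ≡ y × Inverse.to (proj₁ f) v ≡ x)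

IsHamiltonian : ∀ {n} → Graph n → Set
IsHamiltonian {n} G =
  (3 Data.Nat.≤ n) ×
  Σ (Fin n ↔ Fin n) λ h →
    (∀ i j → toℕ j ≡ suc (toℕ i) → Adj G (Inverse.to h i) (Inverse.to h j)) ×
    (∀ i j → toℕ i ≡ n ∸ 1 → toℕ j ≡ 0 → Adj G (Inverse.to h i) (Inverse.to h j))

-- The graph G_{2p}: vertices are pairs (i , j) with i , j ∈ {0..p+1}, i ≠ j.
-- Vertex index t ∈ Fin ((p+2)(p+1)) encodes (i , punchIn i r) where
-- (i , r) = remQuot t; punchIn i enumerates Fin (p+2) ∖ {i}.
vertexPair : ∀ p → Fin ((2 + p) * (1 + p)) → Fin (2 + p) × Fin (2 + p)
vertexPair p t with remQuot {2 + p} (1 + p) t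
... | i , r = i , punchIn i r

eqᵇ : ∀ {m} → Fin m → Fin m → Bool
eqᵇ a b = ⌊ a ≟ b ⌋

G2p : ∀ p → Graph ((2 + p) * (1 + p))
G2p p s t with vertexPair p s | vertexPair p t
... | i , j | k , l =
  (eqᵇ k j ∧ not (eqᵇ l i) ∧ not (eqᵇ l j)) ∨
  (not (eqᵇ k i) ∧ not (eqᵇ k j) ∧ eqᵇ l i)

{-# OPTIONS --safe #-}

-- Existence: colour (i , j) by i; the bichromatic components are stars centred at (i , j) and (j , i).
-- Relabelling by permutations of the indices gives transitivity on vertices and on edges.
--
-- Uniqueness: for every edge uv of a (p+2)-star coloured 2p-regular graph, v is the only neighbour
-- of u with its colour or vice versa, since otherwise there is a bicoloured path u′ v u v′. A vertex
-- is the source of at most p such edges (were all p+1 other colours to occur once, its degree would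
-- be p+1 < 2p), and there are np edges, so both bounds are tight: each u has p neighbours
-- of exactly one colour g u, one of each other colour except its own c u, and every edge uv satisfies
-- exactly one of g u = c v and g v = c u. Counting the edges between two colour classes shows
-- that all classes have n/(p+2) = p+1 vertices and then that u ↦ (c u , g u) is injective. Hence it is
-- an edge-preserving bijection onto the vertices of G₂ₚ, and an isomorphism as the degrees agree.
--
-- Hamiltonicity: a Hamiltonian path of the pairs below 4 is prolonged, for m = 4, 5, …, by
-- (0,m) (m,2) (1,m) (m,3) … (m-3,m) (m,m-1) (m-2,m) (m,1) (m-1,m) (m,0), which visits the pairs with
-- maximum m; its last vertex is adjacent to both (0,m+1) and (0,1).

module Submission where

open import Defs
open import Algebra.Properties.CommutativeSemigroup using (interchange)
open import Data.Bool using (Bool; true; false; _∧_; _∨_; not)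
import Data.Bool.Properties as Bool
open import Data.Fin using (Fin; zero; suc; _≟_; toℕ; fromℕ<; inject₁; remQuot; combine; punchIn; punchOut; _↑ˡ_; _↑ʳ_)
open import Data.Fin.Permutation using (Permutation′; transpose; flip; inverseˡ; inverseʳ; _⟨$⟩ʳ_; _⟨$⟩ˡ_; _∘ₚ_)
open import Data.Fin.Properties
  using (any?; all?; toℕ<n; toℕ-injective; toℕ-fromℕ<; toℕ-inject₁; fromℕ<-injective; injective⇒≤;
         remQuot-combine; combine-remQuot; punchIn-punchOut; punchInᵢ≢i; punchIn-injective; punchOut-injective)
open import Data.Fin.Relation.Unary.Top using (view; ‵fromℕ; ‵inj₁; ‵inject₁)
open import Data.List using (length; filterᵇ; tabulate)
open import Data.Nat using (ℕ; zero; suc; _+_; _*_; _≤_; _<_; _<?_; z≤n; s≤s; z<s; NonZero; >-nonZero)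
import Data.Nat as ℕ
open import Data.Nat.Properties hiding (_≟_; _<?_)
open import Data.Nat.Solver using (module +-*-Solver)
open import Data.Product using (∃; _×_; _,_; proj₁; proj₂; uncurry)
open import Data.Product.Properties using (≡-dec)
open import Data.Sum using (_⊎_; inj₁; inj₂)
open import Data.Unit using (⊤; tt)
open import Data.Vec using (Vec; _∷_; []; lookup)
open import Function using (_∘_; id)
open import Function.Bundles using (_↔_; mk⇔; mk↔ₛ′; Inverse)
open import Function.Definitions using (Injective)
open import Relation.Binary.PropositionalEquality
open import Relation.Nullary using (Dec; ¬_; yes; no; contradiction)
open import Relation.Nullary.Decidable
  using (dec-true; dec-false; isYes≗does; ⌊_⌋; decidable-stable; from-yes; ¬?; _×-dec_; _⊎-dec_; _→-dec_)
open import Algebra.Properties.Semiring.Sum +-*-semiring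

-- Indicators, finite sums and the pigeonhole principle.

ι : Bool → ℕ
ι true  = 1
ι false = 0

δ : ∀ {n} → Fin n → Fin n → ℕ
δ i j = ι (eqᵇ i j)

eqᵇ-refl : ∀ {n} (i : Fin n) → eqᵇ i i ≡ true
eqᵇ-refl i = trans (isYes≗does (i ≟ i)) (dec-true (i ≟ i) refl)

eqᵇ-≢ : ∀ {n} {i j : Fin n} → i ≢ j → eqᵇ i j ≡ false
eqᵇ-≢ {i = i} {j} i≢j = trans (isYes≗does (i ≟ j)) (dec-false (i ≟ j) i≢j)

δ-refl : ∀ {n} (i : Fin n) → δ i i ≡ 1
δ-refl i = cong ι (eqᵇ-refl i)

δ-≢ : ∀ {n} {i j : Fin n} → i ≢ j → δ i j ≡ 0
δ-≢ i≢j = cong ι (eqᵇ-≢ i≢j)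

sum-mono : ∀ {n} {f g : Fin n → ℕ} → (∀ i → f i ≤ g i) → sum f ≤ sum g
sum-mono {zero}  f≤g = z≤n
sum-mono {suc n} f≤g = +-mono-≤ (f≤g zero) (sum-mono (f≤g ∘ suc))

-- When the totals agree, a pointwise bound has no slack at any index. Every double count below
-- becomes a family of pointwise equalities in this way.
sum-tight : ∀ {n} {f g : Fin n → ℕ} → (∀ i → f i ≤ g i) → sum g ≤ sum f → f ≗ g
sum-tight {suc n} {f} {g} f≤g Σg≤Σf zero = ≤-antisym (f≤g zero)
  (+-cancelʳ-≤ _ (g zero) (f zero) (≤-trans (+-monoʳ-≤ (g zero) (sum-mono (f≤g ∘ suc))) Σg≤Σf))
sum-tight {suc n} {f} {g} f≤g Σg≤Σf (suc i) = sum-tight (f≤g ∘ suc)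
  (+-cancelˡ-≤ (f zero) _ _ (≤-trans (+-monoˡ-≤ _ (f≤g zero)) Σg≤Σf)) i

sum-const : ∀ n x → sum {n} (λ _ → x) ≡ n * x
sum-const zero    x = refl
sum-const (suc n) x = cong (x +_) (sum-const n x)

sum-single : ∀ {n} (f : Fin n → ℕ) i → (∀ j → j ≢ i → f j ≡ 0) → sum f ≡ f i
sum-single {suc n} f zero z = trans
  (cong (f zero +_) (trans (sum-cong-≗ {n} (λ j → z (suc j) (λ ()))) (sum-replicate-zero n)))
  (+-identityʳ _)
sum-single {suc n} f (suc i) z = cong₂ _+_ (z zero (λ ()))
  (sum-single (f ∘ suc) i (λ j j≢i → z (suc j) (λ { refl → j≢i refl })))

sum-δˡ : ∀ {n} (f : Fin n → ℕ) i → sum (λ j → δ i j * f j) ≡ f i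
sum-δˡ f i = trans
  (sum-single (λ j → δ i j * f j) i (λ j j≢i → cong (_* f j) (δ-≢ (≢-sym j≢i))))
  (trans (cong (_* f i) (δ-refl i)) (*-identityˡ _))

δ-sym : ∀ {n} (i j : Fin n) → δ i j ≡ δ j i
δ-sym i j with i ≟ j
... | yes refl = sym (δ-refl i)
... | no i≢j   = sym (δ-≢ (≢-sym i≢j))

∑-δ : ∀ {n} (i : Fin n) → ∑[ j < n ] δ i j ≡ 1
∑-δ {n} i = trans (sum-cong-≗ {n} (λ j → sym (*-identityʳ (δ i j)))) (sum-δˡ (λ _ → 1) i)

∑-δ′ : ∀ {n} (i : Fin n) → ∑[ j < n ] δ j i ≡ 1
∑-δ′ i = trans (sum-cong-≗ (λ j → δ-sym j i)) (∑-δ i)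

-- Expanding `h (c v)` against `δ (c v) j` and exchanging the two sums groups the vertices by
-- colour.
sum-fibres : ∀ {n k} (c : Fin n → Fin k) (f : Fin n → ℕ) (h : Fin k → ℕ) →
  ∑[ v < n ] (f v * h (c v)) ≡ ∑[ j < k ] (∑[ v < n ] (f v * δ (c v) j) * h j)
sum-fibres {n} {k} c f h = begin
  ∑[ v < n ] (f v * h (c v))
    ≡⟨ sum-cong-≗ (λ v → trans (cong (f v *_) (sym (sum-δˡ h (c v)))) (*-distribˡ-sum (f v) (λ j → δ (c v) j * h j))) ⟩
  ∑[ v < n ] ∑[ j < k ] (f v * (δ (c v) j * h j))
    ≡⟨ ∑-comm (λ v j → f v * (δ (c v) j * h j)) ⟩
  ∑[ j < k ] ∑[ v < n ] (f v * (δ (c v) j * h j))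
    ≡⟨ sum-cong-≗ (λ j → trans (sum-cong-≗ (λ v → sym (*-assoc (f v) (δ (c v) j) (h j))))
         (sym (*-distribʳ-sum (h j) (λ v → f v * δ (c v) j)))) ⟩
  ∑[ j < k ] (∑[ v < n ] (f v * δ (c v) j) * h j) ∎
  where open ≡-Reasoning

sum-fibres₁ : ∀ {n k} (c : Fin n → Fin k) (f : Fin n → ℕ) →
  sum f ≡ ∑[ j < k ] ∑[ v < n ] (f v * δ (c v) j)
sum-fibres₁ {k = k} c f = trans (sum-cong-≗ (λ v → sym (*-identityʳ (f v))))
  (trans (sum-fibres c f (λ _ → 1)) (sum-cong-≗ {k} (λ j → *-identityʳ _)))

length-filterᵇ-tabulate : ∀ {n} {A : Set} (P : A → Bool) (f : Fin n → A) →
  length (filterᵇ P (tabulate f)) ≡ ∑[ i < n ] ι (P (f i))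
length-filterᵇ-tabulate {zero}  P f = refl
length-filterᵇ-tabulate {suc n} P f with P (f zero)
... | true  = cong suc (length-filterᵇ-tabulate P (f ∘ suc))
... | false = length-filterᵇ-tabulate P (f ∘ suc)

degree≡∑ : ∀ {n} (G : Graph n) v → degree G v ≡ ∑[ w < n ] ι (G v w)
degree≡∑ G v = length-filterᵇ-tabulate (G v) id

sum-splitAt : ∀ m {n} (f : Fin (m + n) → ℕ) →
  sum f ≡ ∑[ i < m ] f (i ↑ˡ n) + ∑[ j < n ] f (m ↑ʳ j)
sum-splitAt zero    f = refl
sum-splitAt (suc m) f = trans (cong (f zero +_) (sum-splitAt m (f ∘ suc))) (sym (+-assoc (f zero) _ _))

sum-combine : ∀ m {n} (f : Fin (m * n) → ℕ) → sum f ≡ ∑[ i < m ] ∑[ j < n ] f (combine i j)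
sum-combine zero    f = refl
sum-combine (suc m) {n} f = trans (sum-splitAt n f)
  (cong (∑[ j < n ] f (j ↑ˡ (m * n)) +_) (sum-combine m (λ t → f (n ↑ʳ t))))

-- Surjectivity is the pigeonhole principle: a missed value could be punched out, leaving an
-- injection of `Fin (suc m)` into `Fin m`.
injective⇒↔ : ∀ {n} (f : Fin n → Fin n) → Injective _≡_ _≡_ f → Fin n ↔ Fin n
injective⇒↔ {n} f inj = mk↔ₛ′ f (proj₁ ∘ surj inj) (proj₂ ∘ surj inj) (λ x → inj (proj₂ (surj inj (f x))))
  where
  surj : ∀ {m} {f : Fin m → Fin m} → Injective _≡_ _≡_ f → ∀ y → ∃ λ x → f x ≡ y
  surj {suc m} {f} inj y with any? (λ x → f x ≟ y)
  ... | yes p = p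
  ... | no ¬p = contradiction
    (injective⇒≤ {f = λ x → punchOut {i = y} {f x} (λ y≡fx → ¬p (x , sym y≡fx))}
      (λ {a} {b} e → inj (punchOut-injective (λ y≡fx → ¬p (a , sym y≡fx)) (λ y≡fx → ¬p (b , sym y≡fx)) e)))
    (<⇒≱ (n<1+n m))

-- If `v` and `w` differed, `f` would lie above `δ v + δ w`, whose sum is 2.
sum≤1⇒unique : ∀ {n} (f : Fin n → ℕ) → sum f ≤ 1 → ∀ {v w} → f v ≡ 1 → f w ≡ 1 → v ≡ w
sum≤1⇒unique {n} f Σf≤1 {v} {w} fv fw = decidable-stable (v ≟ w) λ v≢w →
  contradiction (≤-trans (two v≢w) Σf≤1) (λ { (s≤s ()) })
  where
  below : v ≢ w → ∀ x → δ v x + δ w x ≤ f x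
  below v≢w x with v ≟ x | w ≟ x
  ... | yes refl | yes w≡v = contradiction (sym w≡v) v≢w
  ... | yes refl | no _    = ≤-reflexive (sym fv)
  ... | no _     | yes refl = ≤-reflexive (sym fw)
  ... | no _     | no _    = z≤n
  two : v ≢ w → 2 ≤ sum f
  two v≢w = begin
    2                              ≡⟨ sym (cong₂ _+_ (∑-δ v) (∑-δ w)) ⟩
    sum (δ v) + sum (δ w)          ≡⟨ sym (∑-distrib-+ (δ v) (δ w)) ⟩
    ∑[ x < n ] (δ v x + δ w x)     ≤⟨ sum-mono (below v≢w) ⟩
    sum f                          ∎
    where open ≤-Reasoning

-- This and the next two identities are isolated over variables; `pb≡pa` and `class-size`
-- instantiate them with vertex counts.
[2+p]*a-split : ∀ p a → (2 + p) * a ≡ p * a + a + a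
[2+p]*a-split = solve 2 (λ p a → (con 2 :+ p) :* a := p :* a :+ a :+ a) refl
  where open +-*-Solver

p*[2+p]*a-split : ∀ p a → p * ((2 + p) * a) ≡ p * (p * a + a) + p * a
p*[2+p]*a-split = solve 2 (λ p a → p :* ((con 2 :+ p) :* a) := p :* (p :* a :+ a) :+ p :* a) refl
  where open +-*-Solver

collect-p : ∀ p a b → p * (p * a + a) + p * b ≡ p * (p * a + b + a)
collect-p = solve 3 (λ p a b → p :* (p :* a :+ a) :+ p :* b := p :* (p :* a :+ b :+ a)) refl
  where open +-*-Solver

-- Local structure: the colours around a vertex of a star coloured regular graph.

module StarRegular {n p} (2≤p : 2 ≤ p) (H : Graph n) (H-sym : ∀ u v → H u v ≡ H v u)
  (H-regular : IsRegular (2 * p) H) (c : Fin n → Fin (2 + p)) (c-star : IsStarColouring H c) where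

  q : ℕ
  q = 2 + p

  A : Fin n → Fin n → ℕ
  A u v = ι (H u v)

  A-sym : ∀ u v → A u v ≡ A v u
  A-sym u v = cong ι (H-sym u v)

  -- D u j counts the neighbours of u of colour j.
  D : Fin n → Fin q → ℕ
  D u j = ∑[ w < n ] (A u w * δ (c w) j)

  once : Fin n → Fin q → ℕ
  once u j = ι ⌊ D u j ℕ.≟ 1 ⌋

  proper : ∀ {u v} → Adj H u v → c u ≢ c v
  proper = proj₁ c-star _ _

  Adj-sym : ∀ {u v} → Adj H u v → Adj H v u
  Adj-sym {u} {v} uv = trans (H-sym v u) uv

  ∑A : ∀ u → ∑[ w < n ] A u w ≡ 2 * p
  ∑A u = trans (sym (degree≡∑ H u)) (H-regular u)

  ∑D : ∀ u → ∑[ j < q ] D u j ≡ 2 * p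
  ∑D u = trans (sym (sum-fibres₁ c (A u))) (∑A u)

  D-own : ∀ u → D u (c u) ≡ 0
  D-own u = trans (sum-cong-≗ term) (sum-replicate-zero n)
    where
    term : ∀ w → A u w * δ (c w) (c u) ≡ 0
    term w with H u w in uw
    ... | true  = trans (*-identityˡ (δ (c w) (c u))) (δ-≢ (≢-sym (proper uw)))
    ... | false = refl

  unique-or-second : ∀ {u v} → Adj H u v →
    D u (c v) ≡ 1 ⊎ ∃ λ x → x ≢ v × Adj H u x × c x ≡ c v
  unique-or-second {u} {v} uv
    with any? (λ x → ¬? (x ≟ v) ×-dec (H u x Bool.≟ true) ×-dec (c x ≟ c v))
  ... | yes second = inj₂ second
  ... | no unique  = inj₁ (trans (sum-single (λ w → A u w * δ (c w) (c v)) v other)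
                            (cong₂ _*_ (cong ι uv) (δ-refl (c v))))
    where
    other : ∀ w → w ≢ v → A u w * δ (c w) (c v) ≡ 0
    other w w≢v with H u w in uw
    ... | true  = trans (*-identityˡ (δ (c w) (c v))) (δ-≢ λ cw≡cv → unique (w , w≢v , uw , cw≡cv))
    ... | false = refl

  edge-unique : ∀ {u v} → Adj H u v → D u (c v) ≡ 1 ⊎ D v (c u) ≡ 1
  edge-unique {u} {v} uv with unique-or-second uv | unique-or-second (Adj-sym uv)
  ... | inj₁ D≡1 | _ = inj₁ D≡1
  ... | inj₂ _   | inj₁ D≡1 = inj₂ D≡1
  ... | inj₂ (x , x≢v , ux , cx≡cv) | inj₂ (y , y≢u , vy , cy≡cu) =
    -- The bicoloured path is `x u v y`. Four of the six inequalities follow from properness on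
    -- `uv`, the other two from the choice of `x` and `y`.
    contradiction (cx≡cv , sym cy≡cu) (proj₂ c-star x u v y
      (λ { refl → proper uv cx≡cv }) x≢v
      (λ { refl → proper uv (trans (sym cy≡cu) cx≡cv) })
      (λ { refl → proper uv refl }) (≢-sym y≢u)
      (λ { refl → proper uv (sym cy≡cu) })
      (Adj-sym ux) uv vy)

  once-yes : ∀ {u j} → D u j ≡ 1 → once u j ≡ 1
  once-yes {u} {j} e = cong ι (trans (isYes≗does (D u j ℕ.≟ 1)) (dec-true (D u j ℕ.≟ 1) e))

  once-no : ∀ {u j} → D u j ≢ 1 → once u j ≡ 0
  once-no {u} {j} e = cong ι (trans (isYes≗does (D u j ℕ.≟ 1)) (dec-false (D u j ℕ.≟ 1) e))

  D*once : ∀ u j → D u j * once u j ≡ once u j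
  D*once u j with D u j ℕ.≟ 1
  ... | yes e = trans (*-identityʳ (D u j)) e
  ... | no _  = *-zeroʳ (D u j)

  -- B u v = 1 if v is the only neighbour of u of its colour.
  B : Fin n → Fin n → ℕ
  B u v = A u v * once u (c v)

  -- The numerical form of `edge-unique`, ready to be summed over all pairs.
  A≤B+B : ∀ u v → A u v ≤ B u v + B v u
  A≤B+B u v with H u v in uv
  ... | false = z≤n
  ... | true with edge-unique uv
  ...   | inj₁ e = m≤n⇒m≤n+o _ (≤-reflexive (sym (trans (*-identityˡ (once u (c v))) (once-yes e))))
  ...   | inj₂ e = m≤n⇒m≤o+n _ (≤-reflexive (sym (cong₂ _*_ (cong ι (Adj-sym uv)) (once-yes e))))

  ∑once : Fin n → ℕ
  ∑once u = ∑[ j < q ] once u j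

  -- Grouped by colour, the sum has one term `D u j * once u j` for each `j`, and a colour with
  -- `once u j = 1` has exactly one neighbour.
  ∑B : ∀ u → ∑[ v < n ] B u v ≡ ∑once u
  ∑B u = trans (sum-fibres c (A u) (once u)) (sum-cong-≗ (D*once u))

  ∑1+1 : ∀ (f : Fin q → ℕ) i i′ →
    ∑[ j < q ] (f j + δ i j + δ i′ j) ≡ ∑[ j < q ] f j + 1 + 1
  ∑1+1 f i i′ = trans (∑-distrib-+ (λ j → f j + δ i j) (δ i′))
    (cong₂ _+_ (trans (∑-distrib-+ f (δ i)) (cong (sum f +_) (∑-δ i))) (∑-δ i′))

  -- Abstract, as g would otherwise unfold to this search wherever terms are normalised.
  abstract
    multiple : ∀ u → ∃ λ j → j ≢ c u × D u j ≢ 1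
    multiple u with any? (λ j → ¬? (j ≟ c u) ×-dec ¬? (D u j ℕ.≟ 1))
    ... | yes m = m
    ... | no ¬m = contradiction 2≤p (<⇒≱ (≤-reflexive (cong suc p≡1)))
      where
      D+δ : ∀ j → D u j + δ (c u) j ≡ 1
      D+δ j with c u ≟ j
      ... | yes refl = cong (_+ 1) (D-own u)
      ... | no cu≢j  = trans (+-identityʳ (D u j)) (decidable-stable (D u j ℕ.≟ 1) (λ D≢1 → ¬m (j , ≢-sym cu≢j , D≢1)))
      total : 2 * p + 1 ≡ 2 + p
      total = begin
        2 * p + 1                              ≡⟨ cong₂ _+_ (sym (∑D u)) (sym (∑-δ (c u))) ⟩
        sum (D u) + sum (δ (c u))              ≡⟨ sym (∑-distrib-+ (D u) (δ (c u))) ⟩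
        ∑[ j < q ] (D u j + δ (c u) j)         ≡⟨ sum-cong-≗ D+δ ⟩
        ∑[ j < q ] 1                           ≡⟨ trans (sum-const q 1) (*-identityʳ q) ⟩
        2 + p                                  ∎
        where open ≡-Reasoning
      p≡1 : p ≡ 1
      p≡1 = +-cancelʳ-≡ (1 + p) p 1 (trans (solve 1 (λ x → x :+ (con 1 :+ x) := con 2 :* x :+ con 1) refl p) total)
        where open +-*-Solver

  g : Fin n → Fin q
  g u = proj₁ (multiple u)

  g≢c : ∀ u → g u ≢ c u
  g≢c u = proj₁ (proj₂ (multiple u))

  -- The three cases exclude one another: `c u` does not occur among the neighbours of `u`, while
  -- `g u` differs from `c u` and does not occur exactly once.
  once+δ+δ≤1 : ∀ u j → once u j + δ (c u) j + δ (g u) j ≤ 1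
  once+δ+δ≤1 u j with c u ≟ j | g u ≟ j
  ... | yes refl | yes gu≡cu = contradiction gu≡cu (g≢c u)
  ... | yes refl | no _ rewrite once-no {u} {c u} (λ D≡1 → contradiction (trans (sym (D-own u)) D≡1) (λ ())) = ≤-refl
  ... | no _ | yes refl rewrite once-no {u} {g u} (proj₂ (proj₂ (multiple u))) = ≤-refl
  ... | no _ | no _ with D u j ℕ.≟ 1
  ...   | yes _ = ≤-refl
  ...   | no _  = z≤n

  ∑ones : ∑[ j < q ] 1 ≡ p + 1 + 1
  ∑ones = trans (sum-const q 1) (solve 1 (λ x → (con 2 :+ x) :* con 1 := x :+ con 1 :+ con 1) refl p)
    where open +-*-Solver

  ∑once≤p : ∀ u → ∑once u ≤ p
  ∑once≤p u = +-cancelʳ-≤ 1 _ _ (+-cancelʳ-≤ 1 _ _ (begin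
    ∑once u + 1 + 1                                  ≡⟨ sym (∑1+1 (once u) (c u) (g u)) ⟩
    ∑[ j < q ] (once u j + δ (c u) j + δ (g u) j)    ≤⟨ sum-mono (once+δ+δ≤1 u) ⟩
    ∑[ j < q ] 1                                     ≡⟨ ∑ones ⟩
    p + 1 + 1                                        ∎))
    where open ≤-Reasoning

  ∑∑B : ∑[ u < n ] ∑[ v < n ] (B u v + B v u) ≡ ∑[ u < n ] ∑once u + ∑[ u < n ] ∑once u
  ∑∑B = begin
    ∑[ u < n ] ∑[ v < n ] (B u v + B v u)
      ≡⟨ sum-cong-≗ (λ u → ∑-distrib-+ (B u) (λ v → B v u)) ⟩
    ∑[ u < n ] (∑[ v < n ] B u v + ∑[ v < n ] B v u)
      ≡⟨ ∑-distrib-+ (λ u → ∑[ v < n ] B u v) (λ u → ∑[ v < n ] B v u) ⟩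
    ∑[ u < n ] ∑[ v < n ] B u v + ∑[ u < n ] ∑[ v < n ] B v u
      ≡⟨ cong₂ _+_ (sum-cong-≗ ∑B) (trans (∑-comm (λ u v → B v u)) (sum-cong-≗ ∑B)) ⟩
    ∑[ u < n ] ∑once u + ∑[ u < n ] ∑once u ∎
    where open ≡-Reasoning

  ∑∑A : ∑[ u < n ] ∑[ v < n ] A u v ≡ n * p + n * p
  ∑∑A = trans (sum-cong-≗ ∑A) (trans (sum-const n (2 * p))
    (solve 2 (λ x y → x :* (con 2 :* y) := x :* y :+ x :* y) refl n p))
    where open +-*-Solver

  ∑∑once≤np : ∑[ u < n ] ∑once u ≤ n * p
  ∑∑once≤np = ≤-trans (sum-mono ∑once≤p) (≤-reflexive (sum-const n p))

  ∑∑A≤∑∑B : ∑[ u < n ] ∑[ v < n ] A u v ≤ ∑[ u < n ] ∑[ v < n ] (B u v + B v u)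
  ∑∑A≤∑∑B = sum-mono (λ u → sum-mono (A≤B+B u))

  ∑∑B≤∑∑A : ∑[ u < n ] ∑[ v < n ] (B u v + B v u) ≤ ∑[ u < n ] ∑[ v < n ] A u v
  ∑∑B≤∑∑A = begin
    ∑[ u < n ] ∑[ v < n ] (B u v + B v u)    ≡⟨ ∑∑B ⟩
    ∑[ u < n ] ∑once u + ∑[ u < n ] ∑once u  ≤⟨ +-mono-≤ ∑∑once≤np ∑∑once≤np ⟩
    n * p + n * p                            ≡⟨ sym ∑∑A ⟩
    ∑[ u < n ] ∑[ v < n ] A u v              ∎
    where open ≤-Reasoning

  -- Twice the total of `∑once` is at least the degree sum `2np`, so no vertex can fall short of its
  -- bound `p`.
  ∑once≡p : ∀ u → ∑once u ≡ p
  ∑once≡p = sum-tight ∑once≤p (≤-trans (≤-reflexive (sum-const n p)) (*-cancelˡ-≤ 2 (begin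
    2 * (n * p)                              ≡⟨ double (n * p) ⟩
    n * p + n * p                            ≡⟨ sym ∑∑A ⟩
    ∑[ u < n ] ∑[ v < n ] A u v              ≤⟨ ∑∑A≤∑∑B ⟩
    ∑[ u < n ] ∑[ v < n ] (B u v + B v u)    ≡⟨ ∑∑B ⟩
    ∑[ u < n ] ∑once u + ∑[ u < n ] ∑once u  ≡⟨ sym (double (∑[ u < n ] ∑once u)) ⟩
    2 * ∑[ u < n ] ∑once u                   ∎)))
    where
    open ≤-Reasoning
    double : ∀ x → 2 * x ≡ x + x
    double x = cong (x +_) (+-identityʳ x)

  -- Tightness is applied twice: equal totals give equal row sums, and these give equal entries.
  A≡B+B : ∀ u v → A u v ≡ B u v + B v u
  A≡B+B u = sum-tight (A≤B+B u)
    (≤-reflexive (sym (sum-tight (λ u → sum-mono (A≤B+B u)) ∑∑B≤∑∑A u)))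

  -- Since `∑once u` attains `p`, the three exclusive cases exhaust the `p + 2` colours.
  once+δ+δ≡1 : ∀ u j → once u j + δ (c u) j + δ (g u) j ≡ 1
  once+δ+δ≡1 u = sum-tight (once+δ+δ≤1 u) (≤-reflexive (begin
    ∑[ j < q ] 1                                     ≡⟨ ∑ones ⟩
    p + 1 + 1                                        ≡⟨ cong (λ x → x + 1 + 1) (sym (∑once≡p u)) ⟩
    ∑once u + 1 + 1                                  ≡⟨ sym (∑1+1 (once u) (c u) (g u)) ⟩
    ∑[ j < q ] (once u j + δ (c u) j + δ (g u) j)    ∎))
    where open ≡-Reasoning

  once+δ≡1 : ∀ u {j} → j ≢ c u → once u j + δ (g u) j ≡ 1
  once+δ≡1 u {j} j≢cu = trans
    (cong (_+ δ (g u) j) (sym (trans (cong (once u j +_) (δ-≢ (≢-sym j≢cu))) (+-identityʳ (once u j)))))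
    (once+δ+δ≡1 u j)

  instance
    p-nonZero : NonZero p
    p-nonZero = >-nonZero (<-≤-trans (s≤s z≤n) 2≤p)

  -- At each end the colour of the other end either occurs once or is the value of `g`, which makes
  -- two units in all. By `A≡B+B` exactly one of them is a single occurrence.
  edge-g : ∀ {u v} → Adj H u v → δ (g u) (c v) + δ (g v) (c u) ≡ 1
  edge-g {u} {v} uv = +-cancelˡ-≡ 1 _ _ (begin
    1 + (x + y)             ≡⟨ cong (_+ (x + y)) one ⟩
    (s + t) + (x + y)       ≡⟨ interchange +-commutativeSemigroup s t x y ⟩
    (s + x) + (t + y)       ≡⟨ cong₂ _+_ (once+δ≡1 u (≢-sym (proper uv))) (once+δ≡1 v (proper uv)) ⟩
    2                       ∎)
    where
    open ≡-Reasoning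
    s t x y : ℕ
    s = once u (c v)
    t = once v (c u)
    x = δ (g u) (c v)
    y = δ (g v) (c u)
    one : 1 ≡ s + t
    one = begin
      1                       ≡⟨ sym (cong ι uv) ⟩
      A u v                   ≡⟨ A≡B+B u v ⟩
      A u v * s + A v u * t   ≡⟨ cong₂ (λ a b → a * s + b * t) (cong ι uv) (cong ι (Adj-sym uv)) ⟩
      1 * s + 1 * t           ≡⟨ cong₂ _+_ (*-identityˡ s) (*-identityˡ t) ⟩
      s + t                   ∎

  -- With `g u` excluded, a colour that does not occur once can only be `c u`, and there both sides
  -- are 0.
  D≡once : ∀ u {j} → j ≢ g u → D u j ≡ once u j
  D≡once u {j} j≢gu = compare (D u j ℕ.≟ 1) (c u ≟ j)
    where
    compare : Dec (D u j ≡ 1) → Dec (c u ≡ j) → D u j ≡ once u j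
    compare (yes D≡1) _          = trans D≡1 (sym (once-yes D≡1))
    compare (no D≢1) (yes cu≡j) = trans (subst (λ i → D u i ≡ 0) cu≡j (D-own u)) (sym (once-no D≢1))
    compare (no D≢1) (no cu≢j)  = contradiction
      (trans (sym (cong₂ _+_ (cong₂ _+_ (once-no D≢1) (δ-≢ cu≢j)) (δ-≢ (≢-sym j≢gu)))) (once+δ+δ≡1 u j)) (λ ())

  -- The colours occurring once account for `p` of the `2p` neighbours; the others all have colour
  -- `g u`.
  D-g : ∀ u → D u (g u) ≡ p
  D-g u = +-cancelˡ-≡ p _ _ (begin
    p + D u (g u)
      ≡⟨ cong₂ _+_ (sym (∑once≡p u)) (sym (sum-δˡ (D u) (g u))) ⟩
    sum (once u) + ∑[ j < q ] (δ (g u) j * D u j)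
      ≡⟨ sym (∑-distrib-+ (once u) (λ j → δ (g u) j * D u j)) ⟩
    ∑[ j < q ] (once u j + δ (g u) j * D u j)
      ≡⟨ sum-cong-≗ split ⟩
    ∑[ j < q ] D u j
      ≡⟨ trans (∑D u) (cong (p +_) (+-identityʳ p)) ⟩
    p + p ∎)
    where
    open ≡-Reasoning
    split : ∀ j → once u j + δ (g u) j * D u j ≡ D u j
    split j with g u ≟ j
    ... | yes refl = cong₂ _+_ (once-no (proj₂ (proj₂ (multiple u)))) (*-identityˡ (D u j))
    ... | no gu≢j  = trans (+-identityʳ (once u j)) (sym (D≡once u (≢-sym gu≢j)))

  -- Counting vertices by their colour and their repeated neighbour colour.

  N : Fin q → Fin q → ℕ
  N i j = ∑[ v < n ] (δ (c v) i * δ (g v) j)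

  a b : Fin q → ℕ
  a i = ∑[ v < n ] δ (c v) i
  b j = ∑[ v < n ] δ (g v) j

  N-diag : ∀ i → N i i ≡ 0
  N-diag i = trans (sum-cong-≗ term) (sum-replicate-zero n)
    where
    term : ∀ v → δ (c v) i * δ (g v) i ≡ 0
    term v with c v ≟ i
    ... | yes refl = trans (*-identityˡ (δ (g v) (c v))) (δ-≢ (g≢c v))
    ... | no _     = refl

  ∑N-row : ∀ i → ∑[ j < q ] N i j ≡ a i
  ∑N-row i = sym (sum-fibres₁ g (λ v → δ (c v) i))

  ∑N-col : ∀ j → ∑[ i < q ] N i j ≡ b j
  ∑N-col j = trans (sum-cong-≗ (λ i → sum-cong-≗ (λ v → *-comm (δ (c v) i) (δ (g v) j))))
    (sym (sum-fibres₁ c (λ v → δ (g v) j)))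

  ∑a : ∑[ i < q ] a i ≡ n
  ∑a = trans (∑-comm (λ i v → δ (c v) i))
    (trans (sum-cong-≗ (λ v → ∑-δ (c v))) (trans (sum-const n 1) (*-identityʳ n)))

  -- An edge from colour i to colour j is counted at its end v if g v = j and at its end w if g w ≠ i;
  -- the two conditions are equivalent.
  edge-flip : ∀ {i j} v w →
    δ (c v) i * δ (g v) j * (A v w * δ (c w) j) ≡ δ (c w) j * once w i * (A w v * δ (c v) i)
  edge-flip {i} {j} v w rewrite A-sym w v with H v w in vw | c v ≟ i | c w ≟ j
  ... | false | cv≟i | cw≟j = trans (*-zeroʳ (ι ⌊ cv≟i ⌋ * δ (g v) j)) (sym (*-zeroʳ (ι ⌊ cw≟j ⌋ * once w i)))
  ... | true | no _ | cw≟j = sym (*-zeroʳ (ι ⌊ cw≟j ⌋ * once w i))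
  ... | true | cv≟i | no _ = *-zeroʳ (ι ⌊ cv≟i ⌋ * δ (g v) j)
  ... | true | yes refl | yes refl = cong (λ x → 1 * x * 1) (+-cancelʳ-≡ (δ (g w) (c v)) _ _
    (trans (edge-g vw) (sym (once+δ≡1 w (proper vw)))))

  -- The edges `vw` with `c v = i`, `g v = j` and `c w = j` are counted from both ends: each such
  -- `v` has `p` of them, and each `w` of colour `j` has one unless `g w = i`.
  balance : ∀ {i j} → i ≢ j → p * N i j + N j i ≡ a j
  balance {i} {j} i≢j = begin
    p * N i j + N j i
      ≡⟨ cong (_+ N j i) (trans (*-distribˡ-sum p (λ v → δ (c v) i * δ (g v) j)) (sum-cong-≗ count)) ⟩
    ∑[ v < n ] ∑[ w < n ] (δ (c v) i * δ (g v) j * (A v w * δ (c w) j)) + N j i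
      ≡⟨ cong (_+ N j i) (∑-comm (λ v w → δ (c v) i * δ (g v) j * (A v w * δ (c w) j))) ⟩
    ∑[ w < n ] ∑[ v < n ] (δ (c v) i * δ (g v) j * (A v w * δ (c w) j)) + N j i
      ≡⟨ cong (_+ N j i) (sum-cong-≗ (λ w → sum-cong-≗ (λ v → edge-flip v w))) ⟩
    ∑[ w < n ] ∑[ v < n ] (δ (c w) j * once w i * (A w v * δ (c v) i)) + N j i
      ≡⟨ cong (_+ N j i) (sum-cong-≗ collapse) ⟩
    ∑[ w < n ] (δ (c w) j * once w i) + N j i
      ≡⟨ sym (∑-distrib-+ (λ w → δ (c w) j * once w i) (λ w → δ (c w) j * δ (g w) i)) ⟩
    ∑[ w < n ] (δ (c w) j * once w i + δ (c w) j * δ (g w) i)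
      ≡⟨ sum-cong-≗ merge ⟩
    a j ∎
    where
    open ≡-Reasoning
    count : ∀ v → p * (δ (c v) i * δ (g v) j) ≡ ∑[ w < n ] (δ (c v) i * δ (g v) j * (A v w * δ (c w) j))
    count v with g v ≟ j
    ... | yes refl = trans (*-comm p _) (trans (cong (δ (c v) i * 1 *_) (sym (D-g v)))
      (*-distribˡ-sum (δ (c v) i * 1) (λ w → A v w * δ (c w) (g v))))
    ... | no _ rewrite *-zeroʳ (δ (c v) i) = trans (*-zeroʳ p) (sym (sum-replicate-zero n))
    collapse : ∀ w → ∑[ v < n ] (δ (c w) j * once w i * (A w v * δ (c v) i)) ≡ δ (c w) j * once w i
    collapse w = trans (sym (*-distribˡ-sum (δ (c w) j * once w i) (λ v → A w v * δ (c v) i)))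
      (trans (*-assoc (δ (c w) j) (once w i) (D w i))
        (cong (δ (c w) j *_) (trans (*-comm (once w i) (D w i)) (D*once w i))))
    merge : ∀ w → δ (c w) j * once w i + δ (c w) j * δ (g w) i ≡ δ (c w) j
    merge w with c w ≟ j
    ... | no _     = refl
    ... | yes refl = trans (cong₂ _+_ (*-identityˡ (once w i)) (*-identityˡ (δ (g w) i))) (once+δ≡1 w i≢j)

  -- The term `δ i j * a j` extends the identity to the diagonal, where `N` vanishes, so that it can
  -- be summed over all colours.
  balance′ : ∀ i j → p * N i j + N j i + δ i j * a j ≡ a j
  balance′ i j with i ≟ j
  ... | no i≢j = trans (+-identityʳ (p * N i j + N j i)) (balance i≢j)
  ... | yes refl rewrite N-diag i | *-zeroʳ p = *-identityˡ (a i)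

  ∑-balance : ∀ (s t r : Fin q → ℕ) →
    ∑[ k < q ] (p * s k + t k + r k) ≡ p * sum s + sum t + sum r
  ∑-balance s t r = trans (∑-distrib-+ (λ k → p * s k + t k) r) (cong (_+ sum r)
    (trans (∑-distrib-+ (λ k → p * s k) t) (cong (_+ sum t) (sym (*-distribˡ-sum p s)))))

  -- Sum `balance′` over `i`: the column total of `N` is `b j` and the row total is `a j`. The
  -- factor `p` stays, as `class-size` uses the equation in this form.
  pb≡pa : ∀ j → p * b j ≡ p * a j
  pb≡pa j = +-cancelʳ-≡ (a j) _ _ (+-cancelʳ-≡ (a j) _ _ (begin
    p * b j + a j + a j
      ≡⟨ cong₂ (λ x y → p * x + y + a j) (sym (∑N-col j)) (sym (∑N-row j)) ⟩
    p * ∑[ i < q ] N i j + ∑[ i < q ] N j i + a j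
      ≡⟨ cong (p * ∑[ i < q ] N i j + ∑[ i < q ] N j i +_) (sym δa) ⟩
    p * ∑[ i < q ] N i j + ∑[ i < q ] N j i + ∑[ i < q ] (δ i j * a j)
      ≡⟨ sym (∑-balance (λ i → N i j) (λ i → N j i) (λ i → δ i j * a j)) ⟩
    ∑[ i < q ] (p * N i j + N j i + δ i j * a j)
      ≡⟨ sum-cong-≗ (λ i → balance′ i j) ⟩
    ∑[ i < q ] a j
      ≡⟨ sum-const q (a j) ⟩
    (2 + p) * a j
      ≡⟨ [2+p]*a-split p (a j) ⟩
    p * a j + a j + a j ∎))
    where
    open ≡-Reasoning
    δa : ∑[ i < q ] (δ i j * a j) ≡ a j
    δa = trans (sym (*-distribʳ-sum (a j) (λ i → δ i j)))
      (trans (cong (_* a j) (∑-δ′ j)) (*-identityˡ (a j)))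

  -- Summing `balance′` over the other index gives `p * a i + b i + a i ≡ n`; then `b i` is
  -- exchanged for `a i` by `pb≡pa`.
  class-size : ∀ i → q * a i ≡ n
  class-size i = *-cancelˡ-≡ _ _ p (begin
    p * (q * a i)                 ≡⟨ p*[2+p]*a-split p (a i) ⟩
    p * (p * a i + a i) + p * a i ≡⟨ cong (p * (p * a i + a i) +_) (sym (pb≡pa i)) ⟩
    p * (p * a i + a i) + p * b i ≡⟨ collect-p p (a i) (b i) ⟩
    p * (p * a i + b i + a i)     ≡⟨ cong (p *_) total ⟩
    p * n                         ∎)
    where
    open ≡-Reasoning
    total : p * a i + b i + a i ≡ n
    total = begin
      p * a i + b i + a i
        ≡⟨ cong₂ (λ x y → p * x + y + a i) (sym (∑N-row i)) (sym (∑N-col i)) ⟩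
      p * ∑[ j < q ] N i j + ∑[ j < q ] N j i + a i
        ≡⟨ cong (p * ∑[ j < q ] N i j + ∑[ j < q ] N j i +_) (sym (sum-δˡ a i)) ⟩
      p * ∑[ j < q ] N i j + ∑[ j < q ] N j i + ∑[ j < q ] (δ i j * a j)
        ≡⟨ sym (∑-balance (λ j → N i j) (λ j → N j i) (λ j → δ i j * a j)) ⟩
      ∑[ j < q ] (p * N i j + N j i + δ i j * a j)
        ≡⟨ sum-cong-≗ (balance′ i) ⟩
      ∑[ j < q ] a j
        ≡⟨ ∑a ⟩
      n ∎

  module _ (n≡ : n ≡ (2 + p) * (1 + p)) where

    -- `N i j` counts the vertices that will be sent to the pair `(i , j)`. By `balance′`,
    -- `p * N i j` is at most the class size `p + 1`, which is less than `2p`.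
    N≤1 : ∀ i j → N i j ≤ 1
    N≤1 i j = ≮⇒≥ λ 2≤N → <⇒≱ 2≤p (+-cancelʳ-≤ p p 1 (begin
      p + p                              ≡⟨ solve 1 (λ p → p :+ p := p :* con 2) refl p ⟩
      p * 2                              ≤⟨ *-monoʳ-≤ p 2≤N ⟩
      p * N i j                          ≤⟨ m≤m+n (p * N i j) _ ⟩
      p * N i j + (N j i + δ i j * a j)  ≡⟨ sym (+-assoc (p * N i j) (N j i) (δ i j * a j)) ⟩
      p * N i j + N j i + δ i j * a j    ≡⟨ balance′ i j ⟩
      a j                                ≡⟨ *-cancelˡ-≡ _ _ (2 + p) (trans (class-size j) n≡) ⟩
      1 + p                              ∎))
      where
      open ≤-Reasoning
      open +-*-Solver

    c,g-injective : ∀ {v w} → c v ≡ c w → g v ≡ g w → v ≡ w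
    c,g-injective {v} {w} cv≡cw gv≡gw = sum≤1⇒unique (λ x → δ (c x) (c w) * δ (g x) (g w)) (N≤1 (c w) (g w))
      (cong₂ _*_ (trans (cong (λ i → δ i (c w)) cv≡cw) (δ-refl (c w))) (trans (cong (λ i → δ i (g w)) gv≡gw) (δ-refl (g w))))
      (cong₂ _*_ (δ-refl (c w)) (δ-refl (g w)))

-- Adjacency of index pairs.

arcᵇ : ∀ {q} → Fin q × Fin q → Fin q × Fin q → Bool
arcᵇ (i , j) (k , l) =
  (eqᵇ k j ∧ not (eqᵇ l i) ∧ not (eqᵇ l j)) ∨
  (not (eqᵇ k i) ∧ not (eqᵇ k j) ∧ eqᵇ l i)

-- Polymorphic, since the Hamiltonian walk is built on pairs of natural numbers and only later
-- transferred to `Fin`.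
PairAdj : ∀ {A : Set} → A × A → A × A → Set
PairAdj (i , j) (k , l) = (k ≡ j × l ≢ i × l ≢ j) ⊎ (k ≢ i × k ≢ j × l ≡ i)

arcᵇ⇒PairAdj : ∀ {q} (x y : Fin q × Fin q) → arcᵇ x y ≡ true → PairAdj x y
arcᵇ⇒PairAdj (i , j) (k , l) e with k ≟ j | l ≟ i | l ≟ j | k ≟ i
... | yes k≡j | no l≢i  | no l≢j | _      = inj₁ (k≡j , l≢i , l≢j)
... | no k≢j  | yes l≡i | _      | no k≢i = inj₂ (k≢i , k≢j , l≡i)
arcᵇ⇒PairAdj (i , j) (k , l) () | no _ | no _ | _ | no _
arcᵇ⇒PairAdj (i , j) (k , l) () | no _ | _ | _ | yes _
arcᵇ⇒PairAdj (i , j) (k , l) () | yes _ | yes _ | _ | no _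
arcᵇ⇒PairAdj (i , j) (k , l) () | yes _ | yes _ | _ | yes _
arcᵇ⇒PairAdj (i , j) (k , l) () | yes _ | no _ | yes _ | no _
arcᵇ⇒PairAdj (i , j) (k , l) () | yes _ | no _ | yes _ | yes _

PairAdj⇒arcᵇ : ∀ {q} (x y : Fin q × Fin q) → PairAdj x y → arcᵇ x y ≡ true
PairAdj⇒arcᵇ (i , j) (k , l) (inj₁ (refl , l≢i , l≢j)) rewrite eqᵇ-refl k | eqᵇ-≢ l≢i | eqᵇ-≢ l≢j = refl
PairAdj⇒arcᵇ (i , j) (k , l) (inj₂ (k≢i , k≢j , refl)) rewrite eqᵇ-≢ k≢i | eqᵇ-≢ k≢j | eqᵇ-refl l = refl

PairAdj-sym : ∀ {A : Set} {x y : A × A} → proj₁ x ≢ proj₂ x → proj₁ y ≢ proj₂ y → PairAdj x y → PairAdj y x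
PairAdj-sym i≢j k≢l (inj₁ (refl , l≢i , l≢j)) = inj₂ (i≢j , ≢-sym l≢i , refl)
PairAdj-sym i≢j k≢l (inj₂ (k≢i , k≢j , refl)) = inj₁ (refl , ≢-sym k≢j , ≢-sym i≢j)

PairAdj-irrefl : ∀ {A : Set} (x : A × A) → ¬ PairAdj x x
PairAdj-irrefl _ (inj₁ (_ , _ , l≢j)) = l≢j refl
PairAdj-irrefl _ (inj₂ (k≢i , _))     = k≢i refl

-- The vertices of `G2p`, its simplicity and its star colouring.

Vertex : ℕ → Set
Vertex p = Fin ((2 + p) * (1 + p))

module _ {p : ℕ} where

  vertexPair-≢ : ∀ t → proj₁ (vertexPair p t) ≢ proj₂ (vertexPair p t)
  vertexPair-≢ t e = punchInᵢ≢i (proj₁ (remQuot {2 + p} (1 + p) t)) (proj₂ (remQuot {2 + p} (1 + p) t)) (sym e)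

  vertexPair-combine : ∀ i r → vertexPair p (combine i r) ≡ (i , punchIn i r)
  vertexPair-combine i r = cong (λ x → proj₁ x , punchIn (proj₁ x) (proj₂ x)) (remQuot-combine i r)

  vertexPair-injective : ∀ {s t} → vertexPair p s ≡ vertexPair p t → s ≡ t
  vertexPair-injective {s} {t} e = begin
    s                                            ≡⟨ sym (combine-remQuot {2 + p} (1 + p) s) ⟩
    uncurry combine (remQuot {2 + p} (1 + p) s)  ≡⟨ cong (uncurry combine) (punch-injective (remQuot {2 + p} (1 + p) s) (remQuot {2 + p} (1 + p) t) e) ⟩
    uncurry combine (remQuot {2 + p} (1 + p) t)  ≡⟨ combine-remQuot {2 + p} (1 + p) t ⟩
    t                                            ∎
    where
    open ≡-Reasoning
    punch-injective : ∀ (x y : Fin (2 + p) × Fin (1 + p)) →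
      (proj₁ x , punchIn (proj₁ x) (proj₂ x)) ≡ (proj₁ y , punchIn (proj₁ y) (proj₂ y)) → x ≡ y
    punch-injective (i , r) (k , s) e with cong proj₁ e
    ... | refl = cong (i ,_) (punchIn-injective i r s (cong proj₂ e))

  vertex : ∀ {i j : Fin (2 + p)} → i ≢ j → Vertex p
  vertex {i} i≢j = combine i (punchOut i≢j)

  vertexPair-vertex : ∀ {i j} (i≢j : i ≢ j) → vertexPair p (vertex i≢j) ≡ (i , j)
  vertexPair-vertex {i} i≢j = trans (vertexPair-combine i (punchOut i≢j)) (cong (i ,_) (punchIn-punchOut i≢j))

  Adj⇒PairAdj : ∀ {s t} → Adj (G2p p) s t → PairAdj (vertexPair p s) (vertexPair p t)
  Adj⇒PairAdj {s} {t} = arcᵇ⇒PairAdj (vertexPair p s) (vertexPair p t)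

  PairAdj⇒Adj : ∀ {s t} → PairAdj (vertexPair p s) (vertexPair p t) → Adj (G2p p) s t
  PairAdj⇒Adj {s} {t} = PairAdj⇒arcᵇ (vertexPair p s) (vertexPair p t)

  G2p-Adj-sym : ∀ {s t} → Adj (G2p p) s t → Adj (G2p p) t s
  G2p-Adj-sym {s} {t} st = PairAdj⇒Adj {t} {s} (PairAdj-sym (vertexPair-≢ s) (vertexPair-≢ t) (Adj⇒PairAdj {s} {t} st))

  G2p-simple : IsSimpleGraph (G2p p)
  G2p-simple = (λ s t → Bool.⇔→≡ (mk⇔ (G2p-Adj-sym {s} {t}) (G2p-Adj-sym {t} {s}))) ,
    λ t → Bool.¬-not (PairAdj-irrefl (vertexPair p t) ∘ Adj⇒PairAdj {t} {t})

  colour : Vertex p → Fin (2 + p)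
  colour t = proj₁ (vertexPair p t)

  colour-proper : ∀ {x y : Fin (2 + p) × Fin (2 + p)} → proj₁ x ≢ proj₂ x → PairAdj x y → proj₁ x ≢ proj₁ y
  colour-proper i≢j (inj₁ (refl , _)) = i≢j
  colour-proper i≢j (inj₂ (k≢i , _))  = ≢-sym k≢i

  -- If the second coordinate of `u` is the colour of `v`, a neighbour of `v` coloured as `u` must
  -- be `u`. Otherwise the second coordinate of `v` is the common colour of `u` and `w`, and the
  -- same argument along `v w x` gives `x = v`.
  colour-star : ∀ {u v w x : Fin (2 + p) × Fin (2 + p)} → u ≢ w → v ≢ x → PairAdj u v → PairAdj v w → PairAdj w x →
    ¬ (proj₁ u ≡ proj₁ w × proj₁ v ≡ proj₁ x)
  colour-star u≢w v≢x (inj₁ (refl , b≢i , _)) (inj₁ (i≡b , _)) _ (refl , refl) = b≢i (sym i≡b)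
  colour-star u≢w v≢x (inj₁ (refl , _)) (inj₂ (_ , _ , refl)) _ (refl , refl) = u≢w refl
  colour-star u≢w v≢x (inj₂ (_ , _ , refl)) (inj₁ (_ , a′≢j , _)) (inj₁ (j≡a′ , _)) (refl , refl) = a′≢j (sym j≡a′)
  colour-star u≢w v≢x (inj₂ (_ , _ , refl)) (inj₁ _) (inj₂ (_ , _ , refl)) (refl , refl) = v≢x refl
  colour-star u≢w v≢x (inj₂ (_ , _ , refl)) (inj₂ (_ , i≢b , _)) _ (refl , refl) = i≢b refl

  G2p-star : IsStarColouring (G2p p) colour
  G2p-star = (λ u v uv → colour-proper (vertexPair-≢ u) (Adj⇒PairAdj {u} {v} uv)) ,
    λ u v w x _ u≢w _ _ v≢x _ uv vw wx → colour-star (u≢w ∘ vertexPair-injective) (v≢x ∘ vertexPair-injective)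
      (Adj⇒PairAdj {u} {v} uv) (Adj⇒PairAdj {v} {w} vw) (Adj⇒PairAdj {w} {x} wx)

-- Regularity of `G2p`.

-- Counts arcs by inclusion–exclusion, with the corrections moved to the left to avoid subtraction.
arcs+overlap : ∀ {q} {i j : Fin q} → i ≢ j → ∀ k l →
  ι (arcᵇ (i , j) (k , l)) + δ k j * (δ l i + δ l j) + (δ k i + δ k j) * δ l i ≡ δ k j + δ l i
arcs+overlap {i = i} {j} i≢j k l with k ≟ j | l ≟ i | l ≟ j | k ≟ i
... | yes refl | _ | _ | yes refl = contradiction refl i≢j
... | _ | yes refl | yes refl | _ = contradiction refl i≢j
... | yes _ | yes _ | no _ | no _ = refl
... | yes _ | no _ | yes _ | no _ = refl
... | yes _ | no _ | no _ | no _ = refl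
... | no _ | yes _ | no _ | yes _ = refl
... | no _ | yes _ | no _ | no _ = refl
... | no _ | no _ | yes _ | yes _ = refl
... | no _ | no _ | yes _ | no _ = refl
... | no _ | no _ | no _ | yes _ = refl
... | no _ | no _ | no _ | no _ = refl

-- Lets the degree sum run over all pairs instead of the off-diagonal ones only.
arcᵇ-diag : ∀ {q} (x : Fin q × Fin q) k → ι (arcᵇ x (k , k)) ≡ 0
arcᵇ-diag (i , j) k with k ≟ j | k ≟ i
... | yes _ | yes _ = refl
... | yes _ | no _  = refl
... | no _  | yes _ = refl
... | no _  | no _  = refl

module _ {p : ℕ} where

  private
    q : ℕ
    q = 2 + p

  ∑-arcs : ∀ {i j : Fin q} → i ≢ j → ∑[ k < q ] ∑[ l < q ] ι (arcᵇ (i , j) (k , l)) ≡ 2 * p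
  -- Each of the two overlap terms sums to 2, and the right side of `arcs+overlap` sums to
  -- `2 * (2 + p)`.
  ∑-arcs {i} {j} i≢j = +-cancelʳ-≡ 2 _ _ (+-cancelʳ-≡ 2 _ _ (begin
    ∑[ k < q ] ∑[ l < q ] e k l + 2 + 2
      ≡⟨ cong₂ (λ x y → ∑[ k < q ] ∑[ l < q ] e k l + x + y) (sym two₁) (sym two₂) ⟩
    ∑[ k < q ] ∑[ l < q ] e k l + ∑[ k < q ] ∑[ l < q ] f k l + ∑[ k < q ] ∑[ l < q ] h k l
      ≡⟨ sym (trans (∑∑-distrib (λ k l → e k l + f k l) h) (cong (_+ ∑[ k < q ] ∑[ l < q ] h k l) (∑∑-distrib e f))) ⟩
    ∑[ k < q ] ∑[ l < q ] (e k l + f k l + h k l)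
      ≡⟨ sum-cong-≗ (λ k → sum-cong-≗ (arcs+overlap i≢j k)) ⟩
    ∑[ k < q ] ∑[ l < q ] (δ k j + δ l i)
      ≡⟨ ∑∑-distrib (λ k l → δ k j) (λ k l → δ l i) ⟩
    ∑[ k < q ] ∑[ l < q ] δ k j + ∑[ k < q ] ∑[ l < q ] δ l i
      ≡⟨ cong₂ _+_ (trans (∑-comm {q} {q} (λ k l → δ k j)) (ones j)) (ones i) ⟩
    q + q
      ≡⟨ solve 1 (λ p → (con 2 :+ p) :+ (con 2 :+ p) := con 2 :* p :+ con 2 :+ con 2) refl p ⟩
    2 * p + 2 + 2 ∎))
    where
    open ≡-Reasoning
    open +-*-Solver
    e f h : Fin q → Fin q → ℕ
    e k l = ι (arcᵇ (i , j) (k , l))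
    f k l = δ k j * (δ l i + δ l j)
    h k l = (δ k i + δ k j) * δ l i
    ∑∑-distrib : ∀ (s t : Fin q → Fin q → ℕ) →
      ∑[ k < q ] ∑[ l < q ] (s k l + t k l) ≡ ∑[ k < q ] ∑[ l < q ] s k l + ∑[ k < q ] ∑[ l < q ] t k l
    ∑∑-distrib s t = trans (sum-cong-≗ (λ k → ∑-distrib-+ (s k) (t k)))
      (∑-distrib-+ (λ k → ∑[ l < q ] s k l) (λ k → ∑[ l < q ] t k l))
    ones : ∀ (m : Fin q) → ∑[ k < q ] ∑[ l < q ] δ l m ≡ q
    ones m = trans (sum-cong-≗ {q} (λ _ → ∑-δ′ m)) (trans (sum-const q 1) (*-identityʳ q))
    pair : ∀ (s t : Fin q) → ∑[ k < q ] (δ k s + δ k t) ≡ 2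
    pair s t = trans (∑-distrib-+ (λ k → δ k s) (λ k → δ k t)) (cong₂ _+_ (∑-δ′ s) (∑-δ′ t))
    product : ∀ (s t : Fin q → ℕ) → ∑[ k < q ] ∑[ l < q ] (s k * t l) ≡ sum s * sum t
    product s t = trans (sum-cong-≗ (λ k → sym (*-distribˡ-sum (s k) t))) (sym (*-distribʳ-sum (sum t) s))
    two₁ : ∑[ k < q ] ∑[ l < q ] f k l ≡ 2
    two₁ = trans (product (λ k → δ k j) (λ l → δ l i + δ l j)) (cong₂ _*_ (∑-δ′ j) (pair i j))
    two₂ : ∑[ k < q ] ∑[ l < q ] h k l ≡ 2
    two₂ = trans (product (λ k → δ k i + δ k j) (λ l → δ l i)) (cong₂ _*_ (pair i j) (∑-δ′ i))

  ∑G2p : ∀ s → ∑[ t < q * (1 + p) ] ι (G2p p s t) ≡ 2 * p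
  ∑G2p s = begin
    ∑[ t < q * (1 + p) ] ι (arcᵇ x (vertexPair p t))
      ≡⟨ sum-combine q {1 + p} (λ t → ι (arcᵇ x (vertexPair p t))) ⟩
    ∑[ k < q ] ∑[ r < 1 + p ] ι (arcᵇ x (vertexPair p (combine k r)))
      ≡⟨ sum-cong-≗ (λ k → sum-cong-≗ (λ r → cong (ι ∘ arcᵇ x) (vertexPair-combine k r))) ⟩
    ∑[ k < q ] ∑[ r < 1 + p ] ι (arcᵇ x (k , punchIn k r))
      ≡⟨ sum-cong-≗ (λ k → sym (trans (sum-remove {i = k} (λ l → ι (arcᵇ x (k , l))))
           (cong (_+ ∑[ r < 1 + p ] ι (arcᵇ x (k , punchIn k r))) (arcᵇ-diag x k)))) ⟩
    ∑[ k < q ] ∑[ l < q ] ι (arcᵇ x (k , l))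
      ≡⟨ ∑-arcs (vertexPair-≢ s) ⟩
    2 * p ∎
    where
    open ≡-Reasoning
    x : Fin q × Fin q
    x = vertexPair p s

  G2p-regular : IsRegular (2 * p) (G2p p)
  G2p-regular s = trans (degree≡∑ (G2p p) s) (∑G2p s)

-- Uniqueness of the graph.

-- The injection from the neighbours of u to those of its image is onto, the degrees being equal.
edge-preserving⇒Isomorphic : ∀ {n d} (H G : Graph n) → IsRegular d H → IsRegular d G →
  (f : Fin n ↔ Fin n) → (∀ u v → Adj H u v → Adj G (Inverse.to f u) (Inverse.to f v)) → Isomorphic H G
edge-preserving⇒Isomorphic {n} H G H-reg G-reg f pres = f , λ u v → ι-injective (sym (sum-tight (below u) (same u) v))
  where
  open Inverse f using (to)
  ι-injective : ∀ {x y} → ι x ≡ ι y → x ≡ y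
  ι-injective {true}  {true}  _ = refl
  ι-injective {false} {false} _ = refl
  below : ∀ u v → ι (H u v) ≤ ι (G (to u) (to v))
  below u v with H u v in uv
  ... | false = z≤n
  ... | true  = ≤-reflexive (sym (cong ι (pres u v uv)))
  same : ∀ u → ∑[ v < n ] ι (G (to u) (to v)) ≤ ∑[ v < n ] ι (H u v)
  same u = ≤-reflexive (begin
    ∑[ v < n ] ι (G (to u) (to v))   ≡⟨ sym (sum-permute (λ v → ι (G (to u) v)) f) ⟩
    ∑[ v < n ] ι (G (to u) v)        ≡⟨ sym (degree≡∑ G (to u)) ⟩
    degree G (to u)                  ≡⟨ trans (G-reg (to u)) (sym (H-reg u)) ⟩
    degree H u                       ≡⟨ degree≡∑ H u ⟩
    ∑[ v < n ] ι (H u v)             ∎)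
    where open ≡-Reasoning

-- Turns the exclusive choice in `edge-g` into adjacency; the two inequalities assumed are
-- properness and `g v ≢ c v`.
δ+δ≡1⇒PairAdj : ∀ {q} {i j k l : Fin q} → i ≢ k → l ≢ k → δ j k + δ l i ≡ 1 → PairAdj (i , j) (k , l)
δ+δ≡1⇒PairAdj {i = i} {j} {k} {l} i≢k l≢k e with j ≟ k | l ≟ i
... | yes j≡k | no l≢i  = inj₁ (sym j≡k , l≢i , λ l≡j → l≢k (trans l≡j j≡k))
... | no j≢k  | yes l≡i = inj₂ (≢-sym i≢k , ≢-sym j≢k , l≡i)

unique-star-graph : ∀ {n p} → 2 ≤ p → n ≡ (2 + p) * (1 + p) → (H : Graph n) → IsSimpleGraph H →
  IsRegular (2 * p) H → IsStarColourable (2 + p) H → Isomorphic H (G2p p)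
unique-star-graph {p = p} 2≤p refl H (H-sym , _) H-regular (c , c-star) =
  edge-preserving⇒Isomorphic H (G2p p) H-regular G2p-regular (injective⇒↔ φ φ-injective) λ u v → φ-adj {u} {v}
  where
  open StarRegular 2≤p H H-sym H-regular c c-star
  φ : Vertex p → Vertex p
  φ v = vertex (≢-sym (g≢c v))
  pair-φ : ∀ v → vertexPair p (φ v) ≡ (c v , g v)
  pair-φ v = vertexPair-vertex (≢-sym (g≢c v))
  φ-injective : ∀ {v w} → φ v ≡ φ w → v ≡ w
  φ-injective {v} {w} e = c,g-injective refl (cong proj₁ pairs) (cong proj₂ pairs)
    where
    pairs : (c v , g v) ≡ (c w , g w)
    pairs = trans (sym (pair-φ v)) (trans (cong (vertexPair p) e) (pair-φ w))
  PairAdj-φ : ∀ {u v} → Adj H u v → PairAdj (c u , g u) (c v , g v)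
  PairAdj-φ {u} {v} uv = δ+δ≡1⇒PairAdj (proper uv) (g≢c v) (edge-g uv)
  φ-adj : ∀ {u v} → Adj H u v → Adj (G2p p) (φ u) (φ v)
  φ-adj {u} {v} uv = PairAdj⇒Adj {s = φ u} {φ v} (subst₂ PairAdj (sym (pair-φ u)) (sym (pair-φ v)) (PairAdj-φ uv))

-- Automorphisms of `G2p`: transitivity on vertices and on edges.

module _ {p : ℕ} where

  private
    q : ℕ
    q = 2 + p

    Perm : Set
    Perm = Permutation′ q

  perm-injective : ∀ (π : Perm) {i j} → π ⟨$⟩ʳ i ≡ π ⟨$⟩ʳ j → i ≡ j
  perm-injective π e = trans (sym (inverseˡ π)) (trans (cong (π ⟨$⟩ˡ_) e) (inverseˡ π))

  eqᵇ-perm : ∀ (π : Perm) i j → eqᵇ (π ⟨$⟩ʳ i) (π ⟨$⟩ʳ j) ≡ eqᵇ i j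
  eqᵇ-perm π i j with i ≟ j
  ... | yes refl = eqᵇ-refl (π ⟨$⟩ʳ i)
  ... | no i≢j   = eqᵇ-≢ (i≢j ∘ perm-injective π)

  mapPair : Perm → Fin q × Fin q → Fin q × Fin q
  mapPair π (i , j) = π ⟨$⟩ʳ i , π ⟨$⟩ʳ j

  arcᵇ-perm : ∀ (π : Perm) x y → arcᵇ (mapPair π x) (mapPair π y) ≡ arcᵇ x y
  arcᵇ-perm π (i , j) (k , l)
    rewrite eqᵇ-perm π k j | eqᵇ-perm π l i | eqᵇ-perm π l j | eqᵇ-perm π k i = refl

  relabel : Perm → Vertex p → Vertex p
  relabel π t = vertex (vertexPair-≢ t ∘ perm-injective π)

  vertexPair-relabel : ∀ π t → vertexPair p (relabel π t) ≡ mapPair π (vertexPair p t)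
  vertexPair-relabel π t = vertexPair-vertex (vertexPair-≢ t ∘ perm-injective π)

  relabel-inverse : ∀ (π ρ : Perm) → (∀ i → π ⟨$⟩ʳ (ρ ⟨$⟩ʳ i) ≡ i) → ∀ t → relabel π (relabel ρ t) ≡ t
  relabel-inverse π ρ πρ≗id t = vertexPair-injective (begin
    vertexPair p (relabel π (relabel ρ t))     ≡⟨ vertexPair-relabel π (relabel ρ t) ⟩
    mapPair π (vertexPair p (relabel ρ t))     ≡⟨ cong (mapPair π) (vertexPair-relabel ρ t) ⟩
    mapPair π (mapPair ρ (vertexPair p t))     ≡⟨ cong₂ _,_ (πρ≗id _) (πρ≗id _) ⟩
    vertexPair p t                             ∎)
    where open ≡-Reasoning

  relabelling : Perm → Automorphism (G2p p)
  relabelling π = mk↔ₛ′ (relabel π) (relabel (flip π))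
    (relabel-inverse π (flip π) (λ _ → inverseʳ π)) (relabel-inverse (flip π) π (λ _ → inverseˡ π)) ,
    λ s t → trans (cong₂ arcᵇ (vertexPair-relabel π s) (vertexPair-relabel π t))
      (arcᵇ-perm π (vertexPair p s) (vertexPair p t))

  transpose-fixes : ∀ {a b x : Fin q} → x ≢ a → x ≢ b → transpose a b ⟨$⟩ʳ x ≡ x
  transpose-fixes {a} {b} {x} x≢a x≢b
    rewrite dec-false (x ≟ a) x≢a | dec-false (x ≟ b) x≢b = refl

  transpose-moves : ∀ (a b : Fin q) → transpose a b ⟨$⟩ʳ a ≡ b
  transpose-moves a b rewrite dec-true (a ≟ a) refl = refl

  -- The first transposition brings `i` to `i′`. The second brings the image of `j` to `j′` and
  -- fixes `i′`, which is neither of the points it swaps.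
  pairs-transitive : ∀ {i j i′ j′ : Fin q} → i ≢ j → i′ ≢ j′ →
    ∃ λ π → π ⟨$⟩ʳ i ≡ i′ × π ⟨$⟩ʳ j ≡ j′
  pairs-transitive {i} {j} {i′} {j′} i≢j i′≢j′ = σ ∘ₚ τ ,
    trans (cong (τ ⟨$⟩ʳ_) σi) (transpose-fixes i′≢σj i′≢j′) , transpose-moves (σ ⟨$⟩ʳ j) j′
    where
    σ τ : Perm
    σ = transpose i i′
    τ = transpose (σ ⟨$⟩ʳ j) j′
    σi : σ ⟨$⟩ʳ i ≡ i′
    σi = transpose-moves i i′
    i′≢σj : i′ ≢ σ ⟨$⟩ʳ j
    i′≢σj e = i≢j (perm-injective σ (trans σi e))

  triples-transitive : ∀ {i j l i′ j′ l′ : Fin q} → i ≢ j → l ≢ i → l ≢ j → i′ ≢ j′ → l′ ≢ i′ → l′ ≢ j′ →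
    ∃ λ π → π ⟨$⟩ʳ i ≡ i′ × π ⟨$⟩ʳ j ≡ j′ × π ⟨$⟩ʳ l ≡ l′
  triples-transitive {l = l} {i′} {j′} {l′} i≢j l≢i l≢j i′≢j′ l′≢i′ l′≢j′
    with pairs-transitive i≢j i′≢j′
  ... | σ , refl , refl = σ ∘ₚ transpose (σ ⟨$⟩ʳ l) l′ ,
    transpose-fixes (≢-sym l≢i ∘ perm-injective σ) (≢-sym l′≢i′) ,
    transpose-fixes (≢-sym l≢j ∘ perm-injective σ) (≢-sym l′≢j′) ,
    transpose-moves (σ ⟨$⟩ʳ l) l′

  relabel-≡ : ∀ π u {x} → mapPair π (vertexPair p u) ≡ vertexPair p x → relabel π u ≡ x
  relabel-≡ π u e = vertexPair-injective (trans (vertexPair-relabel π u) e)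

  G2p-vertex-transitive : IsVertexTransitive (G2p p)
  G2p-vertex-transitive u v with pairs-transitive (vertexPair-≢ u) (vertexPair-≢ v)
  ... | π , πi , πj = relabelling π , relabel-≡ π u (cong₂ _,_ πi πj)

  -- An arc from `(i , j)` to `(j , l)` amounts to an ordered triple of distinct indices, so
  -- `triples-transitive` acts transitively on arcs.
  Arc : Fin q × Fin q → Fin q × Fin q → Set
  Arc (i , j) (k , l) = k ≡ j × l ≢ i × l ≢ j

  arc-or-reverse : ∀ {u v} → Adj (G2p p) u v →
    Arc (vertexPair p u) (vertexPair p v) ⊎ Arc (vertexPair p v) (vertexPair p u)
  arc-or-reverse {u} {v} uv with Adj⇒PairAdj {s = u} {v} uv
  ... | inj₁ arc = inj₁ arc
  ... | inj₂ (k≢i , k≢j , l≡i) = inj₂ (sym l≡i , ≢-sym k≢j , λ j≡l → vertexPair-≢ u (sym (trans j≡l l≡i)))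

  arcs-transitive : ∀ u v x y → Arc (vertexPair p u) (vertexPair p v) → Arc (vertexPair p x) (vertexPair p y) →
    ∃ λ π → relabel π u ≡ x × relabel π v ≡ y
  arcs-transitive u v x y (k≡j , l≢i , l≢j) (k′≡j′ , l′≢i′ , l′≢j′)
    with triples-transitive (vertexPair-≢ u) l≢i l≢j (vertexPair-≢ x) l′≢i′ l′≢j′
  ... | π , πi , πj , πl = π , relabel-≡ π u (cong₂ _,_ πi πj) ,
    relabel-≡ π v (cong₂ _,_ (trans (cong (π ⟨$⟩ʳ_) k≡j) (trans πj (sym k′≡j′))) πl)

  G2p-edge-transitive : IsEdgeTransitive (G2p p)
  G2p-edge-transitive u v x y uv xy with arc-or-reverse {u} {v} uv | arc-or-reverse {x} {y} xy
  ... | inj₁ a | inj₁ b = let π , eqs = arcs-transitive u v x y a b in relabelling π , inj₁ eqs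
  ... | inj₁ a | inj₂ b = let π , eqs = arcs-transitive u v y x a b in relabelling π , inj₂ eqs
  ... | inj₂ a | inj₁ b = let π , πv , πu = arcs-transitive v u x y a b in relabelling π , inj₂ (πu , πv)
  ... | inj₂ a | inj₂ b = let π , πv , πu = arcs-transitive v u y x a b in relabelling π , inj₁ (πu , πv)

-- The Hamiltonian cycle.

PairAdj? : ∀ (x y : ℕ × ℕ) → Dec (PairAdj x y)
PairAdj? (i , j) (k , l) =
  ((k ℕ.≟ j) ×-dec ¬? (l ℕ.≟ i) ×-dec ¬? (l ℕ.≟ j)) ⊎-dec (¬? (k ℕ.≟ i) ×-dec ¬? (k ℕ.≟ j) ×-dec (l ℕ.≟ i))

-- Its end `(3 , 0)` is adjacent both to its start, which closes the cycle for `p = 2`, and to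
-- `(0 , 4)`, where the next block begins.
basePath : Vec (ℕ × ℕ) 12
basePath = (0 , 1) ∷ (1 , 2) ∷ (2 , 0) ∷ (0 , 3) ∷ (1 , 0) ∷ (3 , 1)
         ∷ (2 , 3) ∷ (0 , 2) ∷ (2 , 1) ∷ (3 , 2) ∷ (1 , 3) ∷ (3 , 0) ∷ []

-- left k e and right k e are the two steps (k , m) and (m , partner k e) of block m = k + e + 1.
data State : Set where
  base       : Fin 12 → State
  left right : (k e : ℕ) → State

-- The values from 2 to `m - 1` come in order; the last two steps take the remaining 1 and then 0,
-- so that every block ends at `(m , 0)`.
partner : ℕ → ℕ → ℕ
partner k 0             = 0
partner k 1             = 1
partner k (suc (suc e)) = 2 + k

coords : State → ℕ × ℕ
coords (base t)    = lookup basePath t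
coords (left k e)  = k , suc (k + e)
coords (right k e) = suc (k + e) , partner k e

next : State → State
next (base t) with view t
... | ‵fromℕ     = left 0 3
... | ‵inject₁ s = base (suc s)
next (left k e)        = right k e
next (right k 0)       = left 0 (suc k)
next (right k (suc e)) = left (suc k) e

-- The `m * (m - 1)` pairs below `m = k + e + 1` precede its block, and each step `k` of the block
-- visits two pairs.
position : State → ℕ
position (base t)    = toℕ t
position (left k e)  = suc (k + e) * (k + e) + (k + k)
position (right k e) = suc (position (left k e))

-- Blocks start at `m = 4`; the smaller pairs belong to `basePath`.
Valid : State → Set
Valid (base _)    = ⊤
Valid (left k e)  = 3 ≤ k + e
Valid (right k e) = 3 ≤ k + e

walk : ℕ → State
walk zero    = base zero
walk (suc t) = next (walk t)

next-valid : ∀ s → Valid s → Valid (next s)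
next-valid (base t) _ with view t
... | ‵fromℕ   = ≤-refl
... | ‵inj₁ _  = tt
next-valid (left k e) 3≤k+e = 3≤k+e
next-valid (right k 0) 3≤k+0 = m≤n⇒m≤1+n (subst (3 ≤_) (+-identityʳ k) 3≤k+0)
next-valid (right k (suc e)) 3≤k+e = subst (3 ≤_) (+-suc k e) 3≤k+e

position-next : ∀ s → position (next s) ≡ suc (position s)
position-next (base t) with view t
... | ‵fromℕ     = refl
... | ‵inject₁ s = cong suc (sym (toℕ-inject₁ s))
position-next (left k e) = refl
position-next (right k 0) = solve 1 (λ k →
  (con 2 :+ k) :* (con 1 :+ k) :+ con 0 :=
  con 2 :+ ((con 1 :+ (k :+ con 0)) :* (k :+ con 0) :+ (k :+ k))) refl k
  where open +-*-Solver
position-next (right k (suc e)) = solve 2 (λ k e →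
  (con 2 :+ (k :+ e)) :* (con 1 :+ (k :+ e)) :+ ((con 1 :+ k) :+ (con 1 :+ k)) :=
  con 2 :+ ((con 1 :+ (k :+ (con 1 :+ e))) :* (k :+ (con 1 :+ e)) :+ (k :+ k))) refl k e
  where open +-*-Solver

walk-valid : ∀ t → Valid (walk t)
walk-valid zero    = tt
walk-valid (suc t) = next-valid (walk t) (walk-valid t)

position-walk : ∀ t → position (walk t) ≡ t
position-walk zero    = refl
position-walk (suc t) = trans (position-next (walk t)) (cong suc (position-walk t))

k<1+k+e : ∀ k e → k < suc (k + e)
k<1+k+e k e = s≤s (m≤m+n k e)

partner< : ∀ k e → 3 ≤ k + e → partner k e < suc (k + e)
partner< k 0             3≤k+e = z<s
partner< k 1             3≤k+e = s≤s (≤-trans (s≤s z≤n) 3≤k+e)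
partner< k (suc (suc e)) 3≤k+e = s≤s (≤-trans (m≤m+n (2 + k) e)
  (≤-reflexive (sym (trans (+-suc k (suc e)) (cong suc (+-suc k e))))))

partner≢k : ∀ k e → 3 ≤ k + e → partner k e ≢ k
partner≢k k             0             3≤k+e refl = contradiction 3≤k+e (λ ())
partner≢k k             1             3≤k+e refl = contradiction 3≤k+e (λ { (s≤s (s≤s ())) })
partner≢k k             (suc (suc e)) 3≤k+e e≡   = m≢1+n+m k {1} (sym e≡)

base-edge : ∀ (t : Fin 11) → PairAdj (lookup basePath (inject₁ t)) (lookup basePath (suc t))
base-edge = from-yes (all? λ t → PairAdj? (lookup basePath (inject₁ t)) (lookup basePath (suc t)))

base-injective : ∀ s t → lookup basePath s ≡ lookup basePath t → s ≡ t
base-injective = from-yes (all? λ s → all? λ t →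
  ≡-dec ℕ._≟_ ℕ._≟_ (lookup basePath s) (lookup basePath t) →-dec (s ≟ t))

base-bounded : ∀ t → proj₁ (lookup basePath t) < 4 × proj₂ (lookup basePath t) < 4 ×
  proj₁ (lookup basePath t) ≢ proj₂ (lookup basePath t)
base-bounded = from-yes (all? λ t → (proj₁ (lookup basePath t) <? 4) ×-dec (proj₂ (lookup basePath t) <? 4)
  ×-dec ¬? (proj₁ (lookup basePath t) ℕ.≟ proj₂ (lookup basePath t)))

next-edge : ∀ s → Valid s → PairAdj (coords s) (coords (next s))
next-edge (base t) _ with view t
... | ‵fromℕ     = from-yes (PairAdj? (3 , 0) (0 , 4))
... | ‵inject₁ s = base-edge s
next-edge (left k e) v = inj₁ (refl , partner≢k k e v , <⇒≢ (partner< k e v))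
next-edge (right k 0) v = inj₁ (refl , (λ e → 1+n≢n (trans e (cong suc (+-identityʳ k)))) , (λ ()))
next-edge (right k (suc e)) v = inj₂
  ( (λ e≡ → m≢1+m+n k (trans (suc-injective e≡) (+-suc k e)))
  , 1+k≢partner e v
  , cong suc (sym (+-suc k e)))
  where
  1+k≢partner : ∀ e → 3 ≤ k + suc e → suc k ≢ partner k (suc e)
  1+k≢partner zero    v refl = contradiction v (λ { (s≤s ()) })
  1+k≢partner (suc e) v e≡   = 1+n≢n (sym e≡)

coords-≢ : ∀ s → Valid s → proj₁ (coords s) ≢ proj₂ (coords s)
coords-≢ (base t)    _ = proj₂ (proj₂ (base-bounded t))
coords-≢ (left k e)  _ = <⇒≢ (k<1+k+e k e)
coords-≢ (right k e) v = ≢-sym (<⇒≢ (partner< k e v))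

-- Base pairs lie below 4, block pairs have a maximum of at least 4; `left` pairs increase and
-- `right` pairs decrease. Within each kind the maximum fixes the block and the other entry fixes
-- the step.
coords-injective : ∀ s s′ → Valid s → Valid s′ → coords s ≡ coords s′ → position s ≡ position s′
coords-injective (base t) (base t′) _ _ eq = cong toℕ (base-injective t t′ eq)
coords-injective (base t) (left k e) _ v eq = contradiction (subst (_< 4) (cong proj₂ eq) (proj₁ (proj₂ (base-bounded t)))) (≤⇒≯ (s≤s v))
coords-injective (base t) (right k e) _ v eq = contradiction (subst (_< 4) (cong proj₁ eq) (proj₁ (base-bounded t))) (≤⇒≯ (s≤s v))
coords-injective (left k e) (base t) v _ eq = contradiction (subst (_< 4) (sym (cong proj₂ eq)) (proj₁ (proj₂ (base-bounded t)))) (≤⇒≯ (s≤s v))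
coords-injective (right k e) (base t) v _ eq = contradiction (subst (_< 4) (sym (cong proj₁ eq)) (proj₁ (base-bounded t))) (≤⇒≯ (s≤s v))
coords-injective (left k e) (left k′ e′) _ _ eq with cong proj₁ eq
... | refl = cong (λ x → suc x * x + (k + k)) (suc-injective (cong proj₂ eq))
coords-injective (left k e) (right k′ e′) _ v eq =
  contradiction (subst₂ _<_ (cong proj₁ eq) (cong proj₂ eq) (k<1+k+e k e)) (<⇒≯ (partner< k′ e′ v))
coords-injective (right k e) (left k′ e′) v _ eq =
  contradiction (subst₂ _<_ (sym (cong proj₁ eq)) (sym (cong proj₂ eq)) (k<1+k+e k′ e′)) (<⇒≯ (partner< k e v))
coords-injective (right k e) (right k′ e′) _ _ eq =
  cong₂ (λ x k → suc (suc x * x + (k + k))) (suc-injective (cong proj₁ eq))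
    (k≡k′ e e′ (suc-injective (cong proj₁ eq)) (cong proj₂ eq))
  where
  k≡k′ : ∀ e e′ → k + e ≡ k′ + e′ → partner k e ≡ partner k′ e′ → k ≡ k′
  k≡k′ 0 0 sums _ = +-cancelʳ-≡ 0 k k′ sums
  k≡k′ 1 1 sums _ = +-cancelʳ-≡ 1 k k′ sums
  k≡k′ (suc (suc _)) (suc (suc _)) _ eq = suc-injective (suc-injective eq)
  k≡k′ 0 1 _ ()
  k≡k′ 0 (suc (suc _)) _ ()
  k≡k′ 1 0 _ ()
  k≡k′ 1 (suc (suc _)) _ ()
  k≡k′ (suc (suc _)) 0 _ ()
  k≡k′ (suc (suc _)) 1 _ ()

-- For `x > p` the block would start at `(1 + x) * x`, already beyond the last position of the tour.
block≤ : ∀ {x y p} → suc x * x + y < (2 + p) * (1 + p) → x ≤ p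
block≤ {x} {y} {p} lt = ≮⇒≥ λ p<x → <⇒≱ lt (≤-trans (*-mono-≤ (s≤s p<x) p<x) (m≤m+n (suc x * x) y))

coords-bounded : ∀ {p} s → 2 ≤ p → Valid s → position s < (2 + p) * (1 + p) →
  proj₁ (coords s) < 2 + p × proj₂ (coords s) < 2 + p
coords-bounded (base t) 2≤p _ _ = let a , b , _ = base-bounded t in
  <-≤-trans a (+-monoʳ-≤ 2 2≤p) , <-≤-trans b (+-monoʳ-≤ 2 2≤p)
coords-bounded (left k e) _ _ lt = <-trans (k<1+k+e k e) k+e<q , k+e<q
  where k+e<q = s≤s (s≤s (block≤ lt))
coords-bounded (right k e) _ v lt = k+e<q , <-trans (partner< k e v) k+e<q
  where k+e<q = s≤s (s≤s (block≤ (<-trans (n<1+n _) lt)))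

next-block : ∀ x → 2 + (suc x * x + (x + x)) ≡ (2 + x) * (1 + x)
next-block = solve 1 (λ x → con 2 :+ ((con 1 :+ x) :* x :+ (x :+ x)) := (con 2 :+ x) :* (con 1 :+ x)) refl
  where open +-*-Solver

-- The tour ends where a block ends, at `(m , 0)`, which is adjacent to `(0 , 1)`. Any earlier state
-- of a block falls strictly short of the end of that block, hence of the tour.
closing-edge : ∀ {p} s → 2 ≤ p → Valid s → suc (position s) ≡ (2 + p) * (1 + p) → PairAdj (coords s) (0 , 1)
-- There are at least 12 vertices, so only the last entry of `basePath` can end the tour.
closing-edge {p} (base t) 2≤p _ eq = last-edge t (≤-pred (subst (12 ≤_) (sym eq) (*-mono-≤ (+-monoʳ-≤ 2 2≤p) (+-monoʳ-≤ 1 2≤p))))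
  where
  last-edge : ∀ t → 11 ≤ toℕ t → PairAdj (lookup basePath t) (0 , 1)
  last-edge = from-yes (all? λ t → (11 ℕ.≤? toℕ t) →-dec PairAdj? (lookup basePath t) (0 , 1))
closing-edge {p} (left k e) _ _ eq = contradiction eq (<⇒≢ (begin-strict
  suc (suc x * x + (k + k))    ≤⟨ s≤s (+-monoʳ-≤ (suc x * x) (+-mono-≤ (m≤m+n k e) (m≤m+n k e))) ⟩
  suc (suc x * x + (x + x))    <⟨ n<1+n _ ⟩
  2 + (suc x * x + (x + x))    ≡⟨ next-block x ⟩
  (2 + x) * (1 + x)            ≤⟨ *-mono-≤ (s≤s (s≤s x≤p)) (s≤s x≤p) ⟩
  (2 + p) * (1 + p)            ∎))
  where
  open ≤-Reasoning
  x = k + e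
  x≤p : x ≤ p
  x≤p = block≤ {x} {k + k} (≤-reflexive eq)
closing-edge {p} (right k zero) _ v eq = inj₁ (refl , (λ e → contradiction (subst (3 ≤_) (sym (suc-injective e)) v) (λ ())) , (λ ()))
closing-edge {p} (right k (suc e)) _ _ eq = contradiction eq (<⇒≢ (begin-strict
  2 + (suc x * x + (k + k))    <⟨ s≤s (s≤s (+-monoʳ-< (suc x * x) (+-mono-< k<x k<x))) ⟩
  2 + (suc x * x + (x + x))    ≡⟨ next-block x ⟩
  (2 + x) * (1 + x)            ≤⟨ *-mono-≤ (s≤s (s≤s x≤p)) (s≤s x≤p) ⟩
  (2 + p) * (1 + p)            ∎))
  where
  open ≤-Reasoning
  x = k + suc e
  k<x : k < x
  k<x = m<m+n k z<s
  x≤p : x ≤ p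
  x≤p = block≤ {x} {k + k} (≤-trans (n≤1+n _) (≤-reflexive eq))

module _ {p : ℕ} (2≤p : 2 ≤ p) where

  private
    n : ℕ
    n = (2 + p) * (1 + p)

    bounded : ∀ (t : Vertex p) → proj₁ (coords (walk (toℕ t))) < 2 + p × proj₂ (coords (walk (toℕ t))) < 2 + p
    bounded t = coords-bounded (walk (toℕ t)) 2≤p (walk-valid (toℕ t)) (subst (_< n) (sym (position-walk (toℕ t))) (toℕ<n t))

  toℕ² : Fin (2 + p) × Fin (2 + p) → ℕ × ℕ
  toℕ² (i , j) = toℕ i , toℕ j

  toℕ²-reflects-PairAdj : ∀ {x y} → PairAdj (toℕ² x) (toℕ² y) → PairAdj x y
  toℕ²-reflects-PairAdj (inj₁ (a , b , c)) = inj₁ (toℕ-injective a , b ∘ cong toℕ , c ∘ cong toℕ)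
  toℕ²-reflects-PairAdj (inj₂ (a , b , c)) = inj₂ (a ∘ cong toℕ , b ∘ cong toℕ , toℕ-injective c)

  tour : Vertex p → Vertex p
  tour t = vertex {i = fromℕ< (proj₁ (bounded t))} {fromℕ< (proj₂ (bounded t))}
    (coords-≢ (walk (toℕ t)) (walk-valid (toℕ t)) ∘ fromℕ<-injective _ _ (proj₁ (bounded t)) (proj₂ (bounded t)))

  tour-coords : ∀ t → toℕ² (vertexPair p (tour t)) ≡ coords (walk (toℕ t))
  tour-coords t = trans (cong toℕ² (vertexPair-vertex _))
    (cong₂ _,_ (toℕ-fromℕ< (proj₁ (bounded t))) (toℕ-fromℕ< (proj₂ (bounded t))))

  tour-injective : ∀ {s t} → tour s ≡ tour t → s ≡ t
  tour-injective {s} {t} e = toℕ-injective (begin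
    toℕ s                     ≡⟨ sym (position-walk (toℕ s)) ⟩
    position (walk (toℕ s))   ≡⟨ coords-injective (walk (toℕ s)) (walk (toℕ t)) (walk-valid (toℕ s)) (walk-valid (toℕ t))
                                   (trans (sym (tour-coords s)) (trans (cong (toℕ² ∘ vertexPair p) e) (tour-coords t))) ⟩
    position (walk (toℕ t))   ≡⟨ position-walk (toℕ t) ⟩
    toℕ t                     ∎)
    where open ≡-Reasoning

  tour-adj : ∀ s t → PairAdj (coords (walk (toℕ s))) (coords (walk (toℕ t))) → Adj (G2p p) (tour s) (tour t)
  tour-adj s t e = PairAdj⇒Adj {s = tour s} {tour t} (toℕ²-reflects-PairAdj (subst₂ PairAdj (sym (tour-coords s)) (sym (tour-coords t)) e))

  G2p-hamiltonian : IsHamiltonian (G2p p)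
  G2p-hamiltonian = ≤-trans (s≤s (s≤s (s≤s z≤n))) (*-mono-≤ (+-monoʳ-≤ 2 2≤p) (+-monoʳ-≤ 1 2≤p)) ,
    injective⇒↔ tour tour-injective ,
    (λ i j j≡1+i → tour-adj i j (subst (λ t → PairAdj (coords (walk (toℕ i))) (coords (walk t))) (sym j≡1+i)
      (next-edge (walk (toℕ i)) (walk-valid (toℕ i))))) ,
    (λ i j i≡n∸1 j≡0 → tour-adj i j (subst (λ t → PairAdj (coords (walk (toℕ i))) (coords (walk t))) (sym j≡0)
      (closing-edge (walk (toℕ i)) 2≤p (walk-valid (toℕ i))
        (cong suc (trans (position-walk (toℕ i)) i≡n∸1)))))

theorem4 : ∀ (p : ℕ) → 2 ≤ p →
    (IsSimpleGraph (G2p p) × IsRegular (2 * p) (G2p p) × IsStarColourable (p + 2) (G2p p)) ×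
    (∀ (n : ℕ) (H : Graph n) → n ≡ (p + 1) * (p + 2) → IsSimpleGraph H →
    IsRegular (2 * p) H → IsStarColourable (p + 2) H → Isomorphic H (G2p p)) ×
    IsVertexTransitive (G2p p) × IsEdgeTransitive (G2p p) × IsHamiltonian (G2p p)
theorem4 p 2≤p =
  (G2p-simple , G2p-regular , subst (λ k → IsStarColourable k (G2p p)) (+-comm 2 p) (colour , G2p-star)) ,
  (λ n H n≡ simple regular star → unique-star-graph 2≤p
    (trans n≡ (trans (*-comm (p + 1) (p + 2)) (cong₂ _*_ (+-comm p 2) (+-comm p 1)))) H simple regular
    (subst (λ k → IsStarColourable k H) (+-comm p 2) star)) ,
  G2p-vertex-transitive , G2p-edge-transitive , G2p-hamiltonian 2≤p
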